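{- For every integer $m\ge 2$ and every graph $G$, $\hom(S_0;G)\cdot\hom(S_{2,1^{m-2}};G)\ge \hom(S_{2,1^{m-1}};G)$.
   Context: All graphs are finite; $\hom(H;G)$ is the number of graph homomorphisms from $H$ to $G$ (maps $V(H)\to V(G)$ sending edges to edges). $S_0$ is the graph with one vertex and no edges. For $k\ge0$, $S_{2,1^k}$ is the tree with vertex set $\{1,\ldots,k+3\}$ and edge set $\{\{1,j\}:2\le j\le k+2\}\cup\{\{k+2,k+3\}\}$. -}

module Defs where

open import Data.Empty using (⊥)
open import Data.Fin using (Fin; toℕ; finToFun)
open import Data.Fin.Properties using (all?)
open import Data.List using (length; filter; allFin)
open import Data.Nat using (ℕ; suc; _+_; _^_; _≤_; _≤?_; _≟_)
open import Data.Nat.Properties using (1+n≰n; +-suc; 1+n≢n)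
open import Data.Product using (_×_; _,_)
open import Data.Sum using (_⊎_; inj₁; inj₂; swap)
open import Level using (0ℓ)
open import Relation.Binary using (Rel; Decidable; Symmetric; Irreflexive)
open import Relation.Binary.PropositionalEquality using (_≡_; refl; sym; trans)
open import Relation.Nullary using (Dec; no; ¬_)
open import Relation.Nullary.Decidable using (_×-dec_; _⊎-dec_; _→-dec_)

-- Finite simple graphs, with the vertices numbered by Fin order.
record Graph : Set₁ where
  field
    order  : ℕ
    Adj    : Rel (Fin order) 0ℓ
    adj?   : Decidable Adj
    symm   : Symmetric Adj
    irrefl : Irreflexive _≡_ Adj

  Vertex : Set
  Vertex = Fin order

open Graph

IsHom : (H G : Graph) → (Vertex H → Vertex G) → Set
IsHom H G f = ∀ u v → Adj H u v → Adj G (f u) (f v)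

isHom? : (H G : Graph) (f : Vertex H → Vertex G) → Dec (IsHom H G f)
isHom? H G f = all? λ u → all? λ v → adj? H u v →-dec adj? G (f u) (f v)

-- finToFun is the library's bijection (up to pointwise equality) from
-- Fin (n ^ h) to the maps Fin h → Fin n, so every vertex map is tested
-- exactly once.
hom : Graph → Graph → ℕ
hom H G =
  length (filter (λ c → isHom? H G (finToFun c)) (allFin (order G ^ order H)))

S₀ : Graph
S₀ = record
  { order  = 1
  ; Adj    = λ _ _ → ⊥
  ; adj?   = λ _ _ → no λ ()
  ; symm   = λ ()
  ; irrefl = λ _ ()
  }

-- The edges {a , b} of S_{2,1^k}, each listed once with a < b; the
-- vertices are labelled 1, …, k + 3.
Edge : ℕ → Rel ℕ 0ℓ
Edge k a b = (a ≡ 1 × 2 ≤ b × b ≤ k + 2) ⊎ (a ≡ k + 2 × b ≡ k + 3)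

edge? : ∀ k → Decidable (Edge k)
edge? k a b =
  ((a ≟ 1) ×-dec ((2 ≤? b) ×-dec (b ≤? k + 2)))
    ⊎-dec ((a ≟ k + 2) ×-dec (b ≟ k + 3))

edge-irrefl : ∀ k {a} → ¬ Edge k a a
edge-irrefl k (inj₁ (refl , 2≤1 , _)) = 1+n≰n 2≤1
edge-irrefl k (inj₂ (p , q)) = 1+n≢n (trans (sym (+-suc k 2)) (trans (sym q) p))

-- Fin counts from 0, the labels from 1.
label : ∀ {n} → Fin n → ℕ
label i = suc (toℕ i)

-- S₂₁ k is S_{2,1^k}.
S₂₁ : ℕ → Graph
S₂₁ k = record
  { order  = k + 3
  ; Adj    = λ u v → Edge k (label u) (label v) ⊎ Edge k (label v) (label u)
  ; adj?   = λ u v → edge? k (label u) (label v) ⊎-dec edge? k (label v) (label u)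
  ; symm   = swap
  ; irrefl = λ { refl (inj₁ e) → edge-irrefl k e ; refl (inj₂ e) → edge-irrefl k e }
  }

{-# OPTIONS --safe #-}
-- Deleting a leaf at the centre of S_{2,1^{k+1}} leaves S_{2,1^k}.
-- A homomorphism from the larger tree is determined by the image of the deleted
-- vertex, for which there are hom(S_0; G) choices, together with its restriction
-- to the smaller tree, which is again a homomorphism.
module Submission where

open import Data.Fin using (Fin; zero; suc; toℕ; fromℕ<; punchIn; punchOut; combine; finToFun; funToFin; _≟_)
open import Data.Fin.Properties
  using (toℕ-fromℕ<; punchIn-punchOut; combine-injective; injective⇒≤; funToFin-finToFin; finToFun-funToFin)
open import Data.List using (List; length; lookup; allFin; _∷_)
open import Data.List.Membership.Propositional using (_∈_)
open import Data.List.Membership.Propositional.Properties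
  using (∈-filter⁺; ∈-filter⁻; ∈-allFin; ∈-lookup)
open import Data.List.Membership.Setoid.Properties using (index-injective)
open import Data.List.Properties using (filter-all; length-tabulate)
open import Data.List.Relation.Unary.All using (universal) renaming (lookup to lookupAll)
open import Data.List.Relation.Unary.AllPairs using (_∷_)
open import Data.List.Relation.Unary.Any using (index)
open import Data.List.Relation.Unary.Unique.Propositional using (Unique)
open import Data.List.Relation.Unary.Unique.Propositional.Properties using (allFin⁺; filter⁺)
open import Data.Nat using (ℕ; suc; _+_; _*_; _^_; _∸_; _≤_; _<_; _≥_; s≤s; z≤n)
open import Data.Nat.Properties using (m≤n⇒m≤1+n; m≤n+m; ≤-trans; ^-identityʳ; module ≤-Reasoning)
open import Data.Product using (_,_; proj₂)
open import Data.Sum using (inj₁; inj₂) renaming (map to map-⊎)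
open import Function using (_∘_)
open import Function.Definitions using (Injective)
open import Relation.Binary.PropositionalEquality
  using (_≡_; _≗_; refl; sym; trans; cong; cong₂; subst; subst₂; setoid; module ≡-Reasoning)
open import Relation.Nullary using (yes; no; contradiction)
open import Defs

open Graph

lookup-injective : ∀ {A : Set} {xs : List A} → Unique xs → Injective _≡_ _≡_ (lookup xs)
lookup-injective (_  ∷ _) {zero}  {zero}  _  = refl
lookup-injective (x∉ ∷ _) {zero}  {suc j} eq = contradiction eq (lookupAll x∉ (∈-lookup j))
lookup-injective (x∉ ∷ _) {suc i} {zero}  eq = contradiction (sym eq) (lookupAll x∉ (∈-lookup i))
lookup-injective (_  ∷ u) {suc i} {suc j} eq = cong suc (lookup-injective u eq)

-- Positions in `xs` inject into `Fin (n * length ys)`: send a position to the pair of `c x` and the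
-- index at which `f x` occurs in `ys`. Equal indices force equal values of `f`, and uniqueness of
-- `xs` turns equal entries into equal positions.
length≤* : ∀ {A B : Set} {n} {xs : List A} {ys : List B} → Unique xs →
           (c : A → Fin n) (f : A → B) →
           (∀ {x y} → c x ≡ c y → f x ≡ f y → x ≡ y) →
           (∀ {x} → x ∈ xs → f x ∈ ys) →
           length xs ≤ n * length ys
length≤* {B = B} {xs = xs} {ys} unique c f jointly-injective f∈ = injective⇒≤ {f = pair} pair-injective
  where
  f∈ys : ∀ i → f (lookup xs i) ∈ ys
  f∈ys i = f∈ (∈-lookup i)

  pair : Fin (length xs) → Fin _
  pair i = combine (c (lookup xs i)) (index (f∈ys i))

  pair-injective : Injective _≡_ _≡_ pair
  pair-injective {i} {j} eq with c≡ , index≡ ← combine-injective _ _ _ _ eq =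
    lookup-injective unique (jointly-injective c≡ (index-injective (setoid B) (f∈ys i) (f∈ys j) index≡))

funToFin-cong : ∀ {m n} {f g : Fin m → Fin n} → f ≗ g → funToFin f ≡ funToFin g
funToFin-cong {0}     f≗g = refl
funToFin-cong {suc m} f≗g = cong₂ combine (f≗g zero) (funToFin-cong (f≗g ∘ suc))

finToFun-injective : ∀ {m n} {c d : Fin (n ^ m)} → finToFun {n} {m} c ≗ finToFun d → c ≡ d
finToFun-injective {m} {n} {c} {d} eq = begin
  c                                ≡⟨ funToFin-finToFin {m} {n} c ⟨
  funToFin {m} {n} (finToFun c)    ≡⟨ funToFin-cong eq ⟩
  funToFin {m} {n} (finToFun d)    ≡⟨ funToFin-finToFin {m} {n} d ⟩
  d                                ∎
  where open ≡-Reasoning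

-- Every `i` other than `v` is `punchIn v (punchOut v≢i)`.
≗-punchIn : ∀ {A : Set} {n} (v : Fin (suc n)) {f g : Fin (suc n) → A} →
            f v ≡ g v → f ∘ punchIn v ≗ g ∘ punchIn v → f ≗ g
≗-punchIn v {f} {g} fv≡gv f≗g i with v ≟ i
... | yes refl = fv≡gv
... | no v≢i   = subst (λ j → f j ≡ g j) (punchIn-punchOut v≢i) (f≗g (punchOut v≢i))

IsHom-cong : ∀ H G {f g} → f ≗ g → IsHom H G f → IsHom H G g
IsHom-cong H G f≗g hom-f u v = subst₂ (Adj G) (f≗g u) (f≗g v) ∘ hom-f u v

-- H arises from H⁺ by deleting a vertex v and possibly some edges.
hom-delete : ∀ H⁺ H G (v : Fin (suc (order H))) (eq : suc (order H) ≡ order H⁺) →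
             IsHom H H⁺ (subst Fin eq ∘ punchIn v) →
             hom H⁺ G ≤ order G * hom H G
-- Opening the record turns `order H⁺` into a variable, so that `eq` can be matched with `refl` and
-- the `subst` in `embeds` disappears.
hom-delete H⁺@record { order = _ } H G v refl embeds =
  length≤* (filter⁺ (λ c → isHom? H⁺ G (finToFun c)) (allFin⁺ _))
    (λ c → finToFun c v) restrict jointly-injective restrict-∈
  where
  restrict : Fin (order G ^ order H⁺) → Fin (order G ^ order H)
  restrict c = funToFin (finToFun c ∘ punchIn v)

  finToFun-restrict : ∀ c → finToFun (restrict c) ≗ finToFun c ∘ punchIn v
  finToFun-restrict c = finToFun-funToFin (finToFun c ∘ punchIn v)

  jointly-injective : ∀ {c d} → finToFun c v ≡ finToFun d v → restrict c ≡ restrict d → c ≡ d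
  jointly-injective {c} {d} cv≡dv eq = finToFun-injective {suc (order H)} {order G} (≗-punchIn v cv≡dv λ i →
    trans (sym (finToFun-restrict c i))
      (trans (cong (λ e → finToFun e i) eq) (finToFun-restrict d i)))

  restrict-∈ : ∀ {c} → c ∈ _ → restrict c ∈ _
  restrict-∈ {c} c∈ = ∈-filter⁺ (λ c → isHom? H G (finToFun c)) (∈-allFin _)
    (IsHom-cong H G (sym ∘ finToFun-restrict c)
      λ u w → proj₂ (∈-filter⁻ (λ c → isHom? H⁺ G (finToFun c)) {xs = allFin _} c∈) _ _ ∘ embeds u w)

-- With no edges to preserve, the filter discards nothing.
hom-S₀ : ∀ G → hom S₀ G ≡ order G
hom-S₀ G = begin
  hom S₀ G                          ≡⟨ cong length (filter-all (λ c → isHom? S₀ G (finToFun c)) {xs = allFin _} (universal (λ _ _ _ ()) _)) ⟩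
  length (allFin (order G ^ 1))     ≡⟨ length-tabulate _ ⟩
  order G ^ 1                       ≡⟨ ^-identityʳ _ ⟩
  order G                           ∎
  where open ≡-Reasoning

toℕ-punchIn-≥ : ∀ {n} (v : Fin (suc n)) i → toℕ v ≤ toℕ i → toℕ (punchIn v i) ≡ suc (toℕ i)
toℕ-punchIn-≥ zero    i       _         = refl
toℕ-punchIn-≥ (suc v) (suc i) (s≤s v≤i) = cong suc (toℕ-punchIn-≥ v i v≤i)

toℕ-punchIn-< : ∀ {n} (v : Fin (suc n)) i → toℕ i < toℕ v → toℕ (punchIn v i) ≡ toℕ i
toℕ-punchIn-< (suc v) zero    _         = refl
toℕ-punchIn-< (suc v) (suc i) (s≤s i<v) = cong suc (toℕ-punchIn-< v i i<v)

module _ (k : ℕ) where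

  private
    0<k+3 : 0 < k + 3
    0<k+3 = ≤-trans (s≤s z≤n) (m≤n+m 3 k)

  -- The leaf labelled 2.
  leaf : Fin (suc (k + 3))
  leaf = suc (fromℕ< 0<k+3)

  toℕ-leaf : toℕ leaf ≡ 1
  toℕ-leaf = cong suc (toℕ-fromℕ< 0<k+3)

  label-centre : ∀ i → label i ≡ 1 → label (punchIn leaf i) ≡ 1
  label-centre i i≡1 = trans (cong suc (toℕ-punchIn-< leaf i i<leaf)) i≡1
    where
    i<leaf : toℕ i < toℕ leaf
    -- The goal unfolds to `label i ≤ toℕ leaf`, which the two rewrites reduce to `1 ≤ 1`.
    i<leaf rewrite toℕ-leaf | i≡1 = s≤s z≤n

  label-other : ∀ i → 2 ≤ label i → label (punchIn leaf i) ≡ suc (label i)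
  label-other i (s≤s 1≤i) = cong suc (toℕ-punchIn-≥ leaf i (subst (_≤ toℕ i) (sym toℕ-leaf) 1≤i))

  -- Skipping label 2 fixes the centre and raises every other label by one, just as passing from `k`
  -- to `suc k` raises the bounds in `Edge`: the neighbours 2, ..., k+2 of the centre become 3, ...,
  -- k+3, and the outer edge {k+2, k+3} becomes {k+3, k+4}.
  Edge-punchIn : ∀ i j → Edge k (label i) (label j) →
                 Edge (suc k) (label (punchIn leaf i)) (label (punchIn leaf j))
  Edge-punchIn i j (inj₁ (i≡1 , 2≤j , j≤k+2))
    rewrite label-centre i i≡1 | label-other j 2≤j = inj₁ (refl , m≤n⇒m≤1+n 2≤j , s≤s j≤k+2)
  -- Both ends of the outer edge have label at least 2, even for `k = 0`, so both are shifted.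
  Edge-punchIn i j (inj₂ (i≡k+2 , j≡k+3))
    rewrite label-other i (subst (2 ≤_) (sym i≡k+2) (m≤n+m 2 k))
          | label-other j (subst (2 ≤_) (sym j≡k+3) (≤-trans (s≤s (s≤s z≤n)) (m≤n+m 3 k)))
    = inj₂ (cong suc i≡k+2 , cong suc j≡k+3)

  punchIn-leaf-isHom : IsHom (S₂₁ k) (S₂₁ (suc k)) (punchIn leaf)
  punchIn-leaf-isHom u v = map-⊎ (Edge-punchIn u v) (Edge-punchIn v u)

theorem3p1 : (m : ℕ) → 2 ≤ m → (G : Graph) →
    hom S₀ G * hom (S₂₁ (m ∸ 2)) G ≥ hom (S₂₁ (m ∸ 1)) G
theorem3p1 (suc (suc k)) (s≤s (s≤s z≤n)) G = begin
  -- With `m` equal to `suc (suc k)` both subtractions compute, and `refl` matches the vertex counts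
  -- because `suc k + 3` computes to `suc (k + 3)`.
  hom (S₂₁ (suc k)) G         ≤⟨ hom-delete (S₂₁ (suc k)) (S₂₁ k) G (leaf k) refl (punchIn-leaf-isHom k) ⟩
  order G * hom (S₂₁ k) G     ≡⟨ cong (_* hom (S₂₁ k) G) (hom-S₀ G) ⟨
  hom S₀ G * hom (S₂₁ k) G    ∎
  where open ≤-Reasoning
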